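{- For all integers $k\geq1$ and $n\geq0$, $$p(n)=p\left(n-\left\lfloor\frac{n}{k}\right\rfloor k\right)+\sum_{j=0}^{\lfloor n/k\rfloor-1}\nu_k(n-jk),$$ where the sum is empty (equal to $0$) if $n<k$.
   Context: $p(n)$ is the number of integer partitions of $n$, with $p(0)=1$. For $k\geq1$, $\nu_k(n)$ denotes the number of integer partitions of $n$ having no part equal to $k$, with $\nu_k(0):=1$. $\lfloor x\rfloor$ is the floor function. -}

module Defs where

open import Data.List using (List; []; _∷_; length; filter; map; upTo; cartesianProductWith)
open import Data.List.Membership.Propositional using (_∈_)
open import Data.List.Membership.Propositional.Properties
  using (∈-filter⁺; ∈-filter⁻; ∈-map⁺; ∈-upTo⁺; ∈-cartesianProductWith⁺; ∈-cartesianProductWith⁻)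
open import Data.List.Properties using (∷-injective)
open import Data.List.Relation.Unary.All as All using (All; []; _∷_)
open import Data.List.Relation.Unary.AllPairs using ([]; _∷_)
open import Data.List.Relation.Unary.Any using (here; there)
open import Data.List.Relation.Unary.Linked using (Linked; linked?)
open import Data.List.Relation.Unary.Unique.Propositional using (Unique)
import Data.List.Relation.Unary.Unique.Propositional.Properties as Unique
open import Data.Nat using (ℕ; zero; suc; _+_; _≤_; _≥_; _>_; z≤n; s≤s; _≥?_; _>?_; _≟_)
open import Data.Nat.ListAction using (sum)
open import Data.Nat.Properties using (≤-trans; +-mono-≤; m≤m+n; m≤n+m; suc-injective)
open import Data.List.Membership.DecPropositional _≟_ using (_∈?_)
open import Data.Product using (_×_; _,_; proj₂)
open import Function.Bundles using (_⇔_; mk⇔)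
open import Relation.Binary.PropositionalEquality using (_≡_; _≢_; refl)
open import Relation.Nullary using (Dec; ¬?; _×-dec_)

-- Partitions are written with their parts in weakly decreasing order.
IsPartition : ℕ → List ℕ → Set
IsPartition n xs = All (_> 0) xs × Linked _≥_ xs × sum xs ≡ n

isPartition? : ∀ n xs → Dec (IsPartition n xs)
isPartition? n xs = All.all? (_>? 0) xs ×-dec linked? _≥?_ xs ×-dec (sum xs ≟ n)

-- All lists of length at most l with entries in {1, …, m}.
lists : ℕ → ℕ → List (List ℕ)
lists zero    m = [] ∷ []
lists (suc l) m = [] ∷ cartesianProductWith _∷_ (map suc (upTo m)) (lists l m)

-- A partition of n has at most n parts, each at most n, so the bounds below
-- lose nothing; see ∈-partitions and partitions-unique.
partitions : ℕ → List (List ℕ)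
partitions n = filter (isPartition? n) (lists n n)

p : ℕ → ℕ
p n = length (partitions n)

ν : ℕ → ℕ → ℕ
ν k n = length (filter (λ xs → ¬? (k ∈? xs)) (partitions n))

private
  ∈-lists : ∀ {m} l xs → length xs ≤ l → All (_> 0) xs → All (_≤ m) xs → xs ∈ lists l m
  ∈-lists zero    []           _       _        _            = here refl
  ∈-lists (suc l) []           _       _        _            = here refl
  ∈-lists (suc l) (suc x ∷ xs) (s≤s h) (_ ∷ ps) (x<m ∷ bs) =
    there (∈-cartesianProductWith⁺ _∷_ (∈-map⁺ suc (∈-upTo⁺ x<m)) (∈-lists l xs h ps bs))

  length≤sum : ∀ {xs} → All (_> 0) xs → length xs ≤ sum xs
  length≤sum []       = z≤n
  length≤sum (x>0 ∷ ps) = +-mono-≤ x>0 (length≤sum ps)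

  parts≤sum : ∀ xs → All (_≤ sum xs) xs
  parts≤sum []       = []
  parts≤sum (x ∷ xs) =
    m≤m+n x (sum xs) ∷ All.map (λ y≤ → ≤-trans y≤ (m≤n+m (sum xs) x)) (parts≤sum xs)

  lists-unique : ∀ l m → Unique (lists l m)
  lists-unique zero    m = [] ∷ []
  lists-unique (suc l) m =
    All.tabulate []≢ ∷
    Unique.cartesianProductWith⁺ _∷_ ∷-injective
      (Unique.map⁺ suc-injective (Unique.upTo⁺ m)) (lists-unique l m)
    where
    []≢ : ∀ {ys} → ys ∈ cartesianProductWith _∷_ (map suc (upTo m)) (lists l m) → [] ≢ ys
    []≢ ys∈ refl with ∈-cartesianProductWith⁻ _∷_ (map suc (upTo m)) (lists l m) ys∈
    ... | _ , _ , _ , _ , ()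

∈-partitions : ∀ n xs → xs ∈ partitions n ⇔ IsPartition n xs
∈-partitions n xs = mk⇔
  (λ xs∈ → proj₂ (∈-filter⁻ (isPartition? n) {xs = lists n n} xs∈))
  (λ π → ∈-filter⁺ (isPartition? n) (complete π) π)
  where
  complete : IsPartition n xs → xs ∈ lists n n
  complete (pos , _ , refl) = ∈-lists n xs (length≤sum pos) pos (parts≤sum xs)

partitions-unique : ∀ n → Unique (partitions n)
partitions-unique n = Unique.filter⁺ (isPartition? n) (lists-unique n n)

p-zero : p 0 ≡ 1
p-zero = refl

ν-zero : ∀ k → ν k 0 ≡ 1
ν-zero k = refl

{-# OPTIONS --safe #-}

-- Adding a part k is a bijection from the partitions of n − k onto the
-- partitions of n that contain k, so p(n) = ν_k(n) + p(n − k) whenever k ≤ n.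
-- Iterating this ⌊n/k⌋ times gives the formula.

module Submission where

open import Defs
open import Data.List using (List; []; _∷_; _++_; [_]; length; filter; map; upTo)
open import Data.List.Membership.Propositional using (_∈_)
open import Data.List.Membership.Propositional.Properties
  using (∈-filter⁺; ∈-filter⁻; ∈-map⁺; ∈-map⁻; ∈-∃++)
open import Data.List.Membership.Propositional.Properties.WithK using (unique∧set⇒bag)
open import Data.List.Properties using (length-map; map-++; upTo-∷ʳ)
open import Data.List.Relation.Binary.BagAndSetEquality using (∼bag⇒↭)
open import Data.List.Relation.Binary.Permutation.Propositional
  using (_↭_; prep; ↭-sym; ↭-trans; ↭-reflexive; ↭⇒↭ₛ)
open import Data.List.Relation.Binary.Permutation.Propositional.Properties
  using (All-resp-↭; ∈-resp-↭; ↭-length; drop-∷; shift)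
open import Data.List.Relation.Binary.Pointwise using (Pointwise-≡⇒≡)
open import Data.List.Relation.Unary.All as All using (All; []; _∷_)
import Data.List.Relation.Unary.All.Properties as All
open import Data.List.Relation.Unary.AllPairs using ([]; _∷_)
open import Data.List.Relation.Unary.Any using (here)
open import Data.List.Relation.Unary.Linked using (Linked)
open import Data.List.Relation.Unary.Sorted.TotalOrder.Properties using (↗↭↗⇒≋)
open import Data.List.Relation.Unary.Unique.Propositional using (Unique)
import Data.List.Relation.Unary.Unique.Propositional.Properties as Unique
import Data.List.Sort
open import Data.Nat
  using (ℕ; zero; suc; _+_; _*_; _∸_; _≤_; _≥_; NonZero; _≟_; >-nonZero⁻¹)
open import Data.Nat.DivMod using (_/_; m/n*n≤m)
open import Data.Nat.ListAction using (sum)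
open import Data.Nat.ListAction.Properties using (sum-↭; sum-++)
open import Data.Nat.Properties
  using (≤-decTotalOrder; ≤-trans; m≤n+m; m+n≤o⇒m≤o∸n; m+[n∸m]≡n; ∸-+-assoc;
         +-comm; +-assoc; +-suc; +-identityʳ; +-cancelˡ-≡)
open import Data.List.Membership.DecPropositional _≟_ using (_∈?_)
open import Data.Product using (∃-syntax; _×_; _,_)
open import Function using (_∘_)
open import Function.Bundles using (_⇔_; mk⇔; Equivalence)
open import Relation.Binary.Bundles using (DecTotalOrder)
import Relation.Binary.Construct.Flip.EqAndOrd as Flip
open import Relation.Binary.PropositionalEquality
  using (_≡_; refl; sym; trans; cong; module ≡-Reasoning)
open import Relation.Nullary using (¬?; yes; no)
open import Relation.Unary using (Pred; Decidable)

-- Split the partitions of `n` by whether `k` is a part. Those without it are counted by `ν k n`; if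
-- `k ≤ n`, those with it correspond to the partitions of `n ∸ k` by deleting one copy of `k`. This
-- recurrence is `p-step`, and `p-iterate` unfolds it. A weakly decreasing list is determined by its
-- multiset of entries, so the bijection can be checked up to permutation (`descending-↭⇒≡`). It
-- turns into an equality of counts because duplicate-free lists with the same members have the same
-- length (`length-partitions-∋`).

≥-decTotalOrder : DecTotalOrder _ _ _
≥-decTotalOrder = Flip.decTotalOrder ≤-decTotalOrder

open Data.List.Sort ≥-decTotalOrder using (sort; sort-↭; sort-↗)

length-filter-∁ : ∀ {a p} {A : Set a} {P : Pred A p} (P? : Decidable P) xs →
  length xs ≡ length (filter (¬? ∘ P?) xs) + length (filter P? xs)
length-filter-∁ P? []       = refl
length-filter-∁ P? (x ∷ xs) with P? x
... | yes _ = trans (cong suc (length-filter-∁ P? xs)) (sym (+-suc _ _))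
... | no  _ = cong suc (length-filter-∁ P? xs)

-- Injectivity is asked only on `P` because sorting forgets the order of its input: `addPart` is
-- injective on partitions, not on all lists.
map-unique : ∀ {a b p} {A : Set a} {B : Set b} {P : Pred A p} {f : A → B} {xs} →
  (∀ {x y} → P x → P y → f x ≡ f y → x ≡ y) →
  All P xs → Unique xs → Unique (map f xs)
map-unique inj []         []         = []
map-unique inj (px ∷ pxs) (x∉ ∷ xs!) =
  All.map⁺ (All.zipWith (λ (py , x≢y) → x≢y ∘ inj px py) (pxs , x∉)) ∷
  map-unique inj pxs xs!

∈⇒↭∷ : ∀ {a} {A : Set a} {x : A} {xs} → x ∈ xs → ∃[ ys ] xs ↭ x ∷ ys
∈⇒↭∷ x∈xs with as , bs , refl ← ∈-∃++ x∈xs = as ++ bs , shift _ as bs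

descending-↭⇒≡ : ∀ {xs ys} → Linked _≥_ xs → Linked _≥_ ys → xs ↭ ys → xs ≡ ys
descending-↭⇒≡ xs↘ ys↘ xs↭ys =
  Pointwise-≡⇒≡ (↗↭↗⇒≋ (DecTotalOrder.totalOrder ≥-decTotalOrder) xs↘ ys↘ (↭⇒↭ₛ xs↭ys))

module _ (k : ℕ) .{{_ : NonZero k}} where

  -- The sort is taken for the flipped order `≥`, so its output is weakly decreasing.
  addPart : List ℕ → List ℕ
  addPart xs = sort (k ∷ xs)

  addPart-isPartition : ∀ {m xs} → IsPartition m xs → IsPartition (k + m) (addPart xs)
  addPart-isPartition {xs = xs} (pos , _ , Σxs) =
    All-resp-↭ (↭-sym (sort-↭ (k ∷ xs))) (>-nonZero⁻¹ k ∷ pos) ,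
    sort-↗ (k ∷ xs) ,
    trans (sum-↭ (sort-↭ (k ∷ xs))) (cong (k +_) Σxs)

  ∈-addPart : ∀ xs → k ∈ addPart xs
  ∈-addPart xs = ∈-resp-↭ (↭-sym (sort-↭ (k ∷ xs))) (here refl)

  addPart-injective : ∀ {m xs ys} → IsPartition m xs → IsPartition m ys →
    addPart xs ≡ addPart ys → xs ≡ ys
  addPart-injective {xs = xs} {ys} (_ , xs↘ , _) (_ , ys↘ , _) eq =
    descending-↭⇒≡ xs↘ ys↘ (drop-∷
      (↭-trans (↭-sym (sort-↭ (k ∷ xs))) (↭-trans (↭-reflexive eq) (sort-↭ (k ∷ ys)))))

  addPart-surjective : ∀ {m ys} → IsPartition (k + m) ys → k ∈ ys →
    ∃[ xs ] IsPartition m xs × ys ≡ addPart xs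
  addPart-surjective {m} {ys} (pos , ys↘ , Σys) k∈ys
    with zs , ys↭k∷zs ← ∈⇒↭∷ k∈ys =
    -- Only a permutation from `ys` to `k ∷ zs` is known, so the remaining parts are sorted again to
    -- give a partition.
    sort zs ,
    (All.tail (All-resp-↭ ys↭ pos) , sort-↗ zs , +-cancelˡ-≡ k _ _ (trans (sym (sum-↭ ys↭)) Σys)) ,
    descending-↭⇒≡ ys↘ (sort-↗ (k ∷ sort zs)) (↭-trans ys↭ (↭-sym (sort-↭ (k ∷ sort zs))))
    where
    ys↭ : ys ↭ k ∷ sort zs
    ys↭ = ↭-trans ys↭k∷zs (prep k (↭-sym (sort-↭ zs)))

  ∈-map-addPart : ∀ m {ys} →
    ys ∈ map addPart (partitions m) ⇔ ys ∈ filter (k ∈?_) (partitions (k + m))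
  ∈-map-addPart m {ys} = mk⇔ ⇒ ⇐
    where
    open Equivalence using (to; from)

    ⇒ : ys ∈ map addPart (partitions m) → ys ∈ filter (k ∈?_) (partitions (k + m))
    ⇒ ys∈ with xs , xs∈ , refl ← ∈-map⁻ addPart ys∈ =
      ∈-filter⁺ (k ∈?_)
        (from (∈-partitions _ _) (addPart-isPartition (to (∈-partitions m xs) xs∈)))
        (∈-addPart xs)

    ⇐ : ys ∈ filter (k ∈?_) (partitions (k + m)) → ys ∈ map addPart (partitions m)
    ⇐ ys∈
      with ys∈′ , k∈ys ← ∈-filter⁻ (k ∈?_) {xs = partitions (k + m)} ys∈
      with xs , π , refl ← addPart-surjective (to (∈-partitions _ _) ys∈′) k∈ys =
      ∈-map⁺ addPart (from (∈-partitions m xs) π)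

  -- Both lists are duplicate-free, so having the same members makes them equal as bags, hence
  -- permutations of each other.
  length-partitions-∋ : ∀ m → length (filter (k ∈?_) (partitions (k + m))) ≡ p m
  length-partitions-∋ m = trans
    (sym (↭-length (∼bag⇒↭ (unique∧set⇒bag map!
      (Unique.filter⁺ (k ∈?_) (partitions-unique (k + m))) (∈-map-addPart m)))))
    (length-map addPart (partitions m))
    where
    map! : Unique (map addPart (partitions m))
    map! = map-unique addPart-injective
      (All.tabulate (Equivalence.to (∈-partitions m _))) (partitions-unique m)

  p-step : ∀ {n} → k ≤ n → p n ≡ p (n ∸ k) + ν k n
  p-step {n} k≤n = begin
    p n                                               ≡⟨ length-filter-∁ (k ∈?_) (partitions n) ⟩
    ν k n + length (filter (k ∈?_) (partitions n))    ≡⟨ +-comm (ν k n) _ ⟩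
    length (filter (k ∈?_) (partitions n)) + ν k n
      ≡⟨ cong (λ i → length (filter (k ∈?_) (partitions i)) + ν k n) (m+[n∸m]≡n k≤n) ⟨
    length (filter (k ∈?_) (partitions (k + (n ∸ k)))) + ν k n
      ≡⟨ cong (_+ ν k n) (length-partitions-∋ (n ∸ k)) ⟩
    p (n ∸ k) + ν k n                                 ∎
    where open ≡-Reasoning

  -- Induction on the number `q` of rounds; `q * k ≤ n` keeps every truncated subtraction exact.
  p-iterate : ∀ n q → q * k ≤ n →
    p n ≡ p (n ∸ q * k) + sum (map (λ j → ν k (n ∸ j * k)) (upTo q))
  p-iterate n zero    _    = sym (+-identityʳ (p n))
  p-iterate n (suc q) qk≤n = begin
    p n
      ≡⟨ p-iterate n q (≤-trans (m≤n+m (q * k) k) qk≤n) ⟩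
    p (n ∸ q * k) + S q
      -- `suc q * k` unfolds to `k + q * k`, so the hypothesis leaves room for one more `k` in
      -- `n ∸ q * k`.
      ≡⟨ cong (_+ S q) (p-step (m+n≤o⇒m≤o∸n k qk≤n)) ⟩
    p (n ∸ q * k ∸ k) + f q + S q
      ≡⟨ cong (λ i → p i + f q + S q) (trans (∸-+-assoc n (q * k) k) (cong (n ∸_) (+-comm (q * k) k))) ⟩
    p (n ∸ suc q * k) + f q + S q
      ≡⟨ +-assoc (p (n ∸ suc q * k)) (f q) (S q) ⟩
    p (n ∸ suc q * k) + (f q + S q)
      ≡⟨ cong (p (n ∸ suc q * k) +_) S-suc ⟩
    p (n ∸ suc q * k) + S (suc q)
      ∎
    where
    open ≡-Reasoning

    f : ℕ → ℕ
    f j = ν k (n ∸ j * k)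

    S : ℕ → ℕ
    S i = sum (map f (upTo i))

    -- The new term has index `q`, the last entry of `upTo (suc q)`, so it is split off at the end
    -- of the list.
    S-suc : f q + S q ≡ S (suc q)
    S-suc = begin
      f q + S q                      ≡⟨ +-comm (f q) (S q) ⟩
      S q + f q                      ≡⟨ cong (S q +_) (+-identityʳ (f q)) ⟨
      S q + sum [ f q ]              ≡⟨ sum-++ (map f (upTo q)) [ f q ] ⟨
      sum (map f (upTo q) ++ [ f q ]) ≡⟨ cong sum (map-++ f (upTo q) [ q ]) ⟨
      sum (map f (upTo q ++ [ q ]))  ≡⟨ cong (sum ∘ map f) (upTo-∷ʳ q) ⟩
      S (suc q)                      ∎

mainTheorem5 : ∀ (k n : ℕ) .{{_ : NonZero k}} →
    p n ≡ p (n ∸ (n / k) * k) + sum (map (λ j → ν k (n ∸ j * k)) (upTo (n / k)))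
mainTheorem5 k n = p-iterate k n (n / k) (m/n*n≤m n k)
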